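{- There is no derivation $\Delta$ in $\mathsf{SNEL}$ such that the !-?-flow-graph of $\Delta$ contains an unforked cycle.
   Context: Atoms: countably many atoms $a,b,\dots$, each atom $a$ having a dual atom $\bar a$ with $\bar{\bar a}=a$. Structures are generated by $S::= a\mid \circ \mid [S,\dots,S]\mid (S,\dots,S)\mid \langle S;\dots;S\rangle \mid ?S\mid !S\mid \bar S$ (par, tensor, seq with at least one argument; unit $\circ$ not an atom), identified modulo the least congruence $=$ making par, tensor, seq associative, par and tensor commutative, $\circ$ a unit for all three, $[R]=(R)=\langle R\rangle=R$, and with De Morgan laws $\bar\circ=\circ$, $\overline{[R_1,\dots,R_h]}=(\bar R_1,\dots,\bar R_h)$, $\overline{(R_1,\dots,R_h)}=[\bar R_1,\dots,\bar R_h]$, $\overline{\langle R_1;\dots;R_h\rangle}=\langle\bar R_1;\dots;\bar R_h\rangle$, $\overline{?R}=!\bar R$, $\overline{!R}=?\bar R$, $\bar{\bar R}=R$. A context $S\{\;\}$ is a structure with one hole not under negation; $S[R,T]$ abbreviates $S\{[R,T]\}$ etc. A derivation in a rule set is a finite vertical chain of rule instances (each conclusion equal modulo $=$ to the next premise), possibly a single structure; top = premise, bottom = conclusion. System $\mathsf{SNEL}$ has the rules (premise $\Rightarrow$ conclusion): $\mathsf{ai}\downarrow$: $S\{\circ\}\Rightarrow S[a,\bar a]$; $\mathsf{ai}\uparrow$: $S(a,\bar a)\Rightarrow S\{\circ\}$; $\mathsf{s}$: $S([R,U],T)\Rightarrow S[(R,T),U]$; $\mathsf{q}\downarrow$: $S\langle[R,U];[T,V]\rangle\Rightarrow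 S[\langle R;T\rangle,\langle U;V\rangle]$; $\mathsf{q}\uparrow$: $S(\langle R;U\rangle,\langle T;V\rangle)\Rightarrow S\langle(R,T);(U,V)\rangle$; $\mathsf{p}\downarrow$: $S\{![R,T]\}\Rightarrow S[!R,?T]$; $\mathsf{p}\uparrow$: $S(?R,!T)\Rightarrow S\{?(R,T)\}$; $\mathsf{e}\downarrow$: $S\{\circ\}\Rightarrow S\{!\circ\}$; $\mathsf{e}\uparrow$: $S\{?\circ\}\Rightarrow S\{\circ\}$; $\mathsf{w}\downarrow$: $S\{\circ\}\Rightarrow S\{?R\}$; $\mathsf{w}\uparrow$: $S\{!R\}\Rightarrow S\{\circ\}$; $\mathsf{b}\downarrow$: $S[?R,R]\Rightarrow S\{?R\}$; $\mathsf{b}\uparrow$: $S\{!R\}\Rightarrow S(!R,R)$; $\mathsf{g}\downarrow$: $S\{??R\}\Rightarrow S\{?R\}$; $\mathsf{g}\uparrow$: $S\{!R\}\Rightarrow S\{!!R\}$. !-?-flow-graph of a derivation $\Delta$: a directed graph whose vertices are the occurrences of substructures of the form $!R$ (!-vertices) and $?T$ (?-vertices) in the lines of $\Delta$ (occurrences in different lines are distinct vertices). Edges are given for each rule instance: (1) each !- or ?-occurrence that the instance leaves unchanged (it lies in the context $S$, possibly containing the rewritten part, or inside one of the schematic structures $R,T,U,V$ carried unchanged from premise to conclusion) yields an edge from its occurrence in the conclusion to its occurrence in the premise if it is a !-occurrence, and from premise to conclusion if it is a ?-occurrence; (2) for $\mathsf{b}\uparrow$ ($S\{!R\}\Rightarrow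 S(!R,R)$): an edge from the displayed $!R$ of the conclusion to $!R$ of the premise; each !-occurrence inside $R$ in the premise receives an edge from each of its two copies in the conclusion, and each ?-occurrence inside $R$ in the premise has an edge to each of its two copies in the conclusion; dually for $\mathsf{b}\downarrow$ ($S[?T,T]\Rightarrow S\{?T\}$): an edge from the displayed $?T$ of the premise to $?T$ of the conclusion, each ?-occurrence inside $T$ in the conclusion receives an edge from each of its two copies in the premise, and each !-occurrence inside $T$ in the conclusion has an edge to each of its two copies in the premise; (3) for $\mathsf{g}\uparrow$ ($S\{!R\}\Rightarrow S\{!!R\}$): edges from both $!!R$ and its inner $!R$ in the conclusion to $!R$ in the premise; for $\mathsf{g}\downarrow$ ($S\{??T\}\Rightarrow S\{?T\}$): edges from both $??T$ and its inner $?T$ in the premise to $?T$ in the conclusion; (4) for $\mathsf{p}\downarrow$ ($S\{![R,T]\}\Rightarrow S[!R,?T]$): an edge from $!R$ in the conclusion to $![R,T]$ in the premise and an edge from $!R$ to $?T$, both in the conclusion; for $\mathsf{p}\uparrow$ ($S(?R,!T)\Rightarrow S\{?(R,T)\}$): an edge from $?R$ in the premise to $?(R,T)$ in the conclusion and an edge from $?R$ to $!T$, both in the premise. There are no other edges. A cycle is a nonempty sequence of vertices with consecutive edges whose first and last vertices coincide. A cycle $c$ is forked if some instance of $\mathsf{b}\uparrow$ ($S\{!R\}\Rightarrow S(!R,R)$) has vertices of $c$ in both copies of $R$ in its conclusion (the one inside $!R$ and the other), or some instance of $\mathsf{b}\downarrow$ ($S[?T,T]\Rightarrow S\{?T\}$)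 has vertices of $c$ in both copies of $T$ in its premise; otherwise $c$ is unforked. -}

module Defs where

open import Data.Nat using (ℕ)
open import Data.Bool using (Bool; not)
open import Data.Fin using (Fin; suc; inject₁)
open import Data.List using (List; []; _∷_; _++_)
open import Data.List.Membership.Propositional using (_∈_)
open import Data.Maybe using (Maybe; just; nothing)
open import Data.Product using (Σ; ∃; _×_; _,_)
open import Data.Sum using (_⊎_)
open import Relation.Binary.PropositionalEquality using (_≡_)
open import Relation.Nullary using (¬_)

-- Atoms: countably many, each with a dual; dual (dual a) = a.
-- An atom is a name with a polarity.

Atom : Set
Atom = ℕ × Bool

dual : Atom → Atom
dual (n , b) = (n , not b)

-- Structures in negation normal form (negation pushed to atoms by the
-- De Morgan laws). Binary par/tensor/seq; n-ary ones and the unit laws are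
-- obtained through the explicit equality steps below.

data Op : Set where
  Par Ten Seq : Op

data Str : Set where
  atom : Atom → Str
  unit : Str
  bin  : Op → Str → Str → Str
  why  : Str → Str
  bang : Str → Str

-- Positions (occurrences) are paths from the root.
data Dir : Set where
  l r i : Dir

Path : Set
Path = List Dir

sub : Str → Path → Maybe Str
sub s [] = just s
sub (bin o a b) (l ∷ p) = sub a p
sub (bin o a b) (r ∷ p) = sub b p
sub (why a) (i ∷ p) = sub a p
sub (bang a) (i ∷ p) = sub a p
sub _ (_ ∷ _) = nothing

data Kind : Set where
  bangK whyK : Kind

kindOf : Maybe Str → Maybe Kind
kindOf (just (bang _)) = just bangK
kindOf (just (why _)) = just whyK
kindOf _ = nothing

kindAt : Str → Path → Maybe Kind
kindAt s p = kindOf (sub s p)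

-- Contexts S{ } (one hole, never under negation in NNF).

data Ctx : Set where
  hole  : Ctx
  binL  : Op → Ctx → Str → Ctx
  binR  : Op → Str → Ctx → Ctx
  whyC  : Ctx → Ctx
  bangC : Ctx → Ctx

plug : Ctx → Str → Str
plug hole s = s
plug (binL o C t) s = bin o (plug C s) t
plug (binR o t C) s = bin o t (plug C s)
plug (whyC C) s = why (plug C s)
plug (bangC C) s = bang (plug C s)

holePath : Ctx → Path
holePath hole = []
holePath (binL o C t) = l ∷ holePath C
holePath (binR o t C) = r ∷ holePath C
holePath (whyC C) = i ∷ holePath C
holePath (bangC C) = i ∷ holePath C

-- Local steps: the rules of SNEL (premise, conclusion), plus elementary
-- steps of the equational theory = (associativity, commutativity of par
-- and tensor, unit laws), in both directions.

data Rule : Str → Str → Set where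
  ai↓ : (a : Atom) → Rule unit (bin Par (atom a) (atom (dual a)))
  ai↑ : (a : Atom) → Rule (bin Ten (atom a) (atom (dual a))) unit
  s   : (R T U : Str) → Rule (bin Ten (bin Par R U) T) (bin Par (bin Ten R T) U)
  q↓  : (R T U V : Str) →
        Rule (bin Seq (bin Par R U) (bin Par T V)) (bin Par (bin Seq R T) (bin Seq U V))
  q↑  : (R T U V : Str) →
        Rule (bin Ten (bin Seq R U) (bin Seq T V)) (bin Seq (bin Ten R T) (bin Ten U V))
  p↓  : (R T : Str) → Rule (bang (bin Par R T)) (bin Par (bang R) (why T))
  p↑  : (R T : Str) → Rule (bin Ten (why R) (bang T)) (why (bin Ten R T))
  e↓  : Rule unit (bang unit)
  e↑  : Rule (why unit) unit
  w↓  : (R : Str) → Rule unit (why R)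
  w↑  : (R : Str) → Rule (bang R) unit
  b↓  : (T : Str) → Rule (bin Par (why T) T) (why T)
  b↑  : (R : Str) → Rule (bang R) (bin Ten (bang R) R)
  g↓  : (T : Str) → Rule (why (why T)) (why T)
  g↑  : (R : Str) → Rule (bang R) (bang (bang R))
  assoc→ : (o : Op) (A B C : Str) → Rule (bin o (bin o A B) C) (bin o A (bin o B C))
  assoc← : (o : Op) (A B C : Str) → Rule (bin o A (bin o B C)) (bin o (bin o A B) C)
  commPar : (A B : Str) → Rule (bin Par A B) (bin Par B A)
  commTen : (A B : Str) → Rule (bin Ten A B) (bin Ten B A)
  unitR→ : (o : Op) (A : Str) → Rule (bin o A unit) A
  unitR← : (o : Op) (A : Str) → Rule A (bin o A unit)
  unitL→ : (o : Op) (A : Str) → Rule (bin o unit A) A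
  unitL← : (o : Op) (A : Str) → Rule A (bin o unit A)

-- Schematic subterms carried unchanged: (position in premise, position in
-- conclusion); everything below them is traced as well.
carried : ∀ {P Q} → Rule P Q → List (Path × Path)
carried (ai↓ a) = []
carried (ai↑ a) = []
carried (s R T U) = (l ∷ l ∷ [] , l ∷ l ∷ []) ∷ (l ∷ r ∷ [] , r ∷ []) ∷ (r ∷ [] , l ∷ r ∷ []) ∷ []
carried (q↓ R T U V) =
  (l ∷ l ∷ [] , l ∷ l ∷ []) ∷ (l ∷ r ∷ [] , r ∷ l ∷ []) ∷
  (r ∷ l ∷ [] , l ∷ r ∷ []) ∷ (r ∷ r ∷ [] , r ∷ r ∷ []) ∷ []
carried (q↑ R T U V) =
  (l ∷ l ∷ [] , l ∷ l ∷ []) ∷ (l ∷ r ∷ [] , r ∷ l ∷ []) ∷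
  (r ∷ l ∷ [] , l ∷ r ∷ []) ∷ (r ∷ r ∷ [] , r ∷ r ∷ []) ∷ []
carried (p↓ R T) = (i ∷ l ∷ [] , l ∷ i ∷ []) ∷ (i ∷ r ∷ [] , r ∷ i ∷ []) ∷ []
carried (p↑ R T) = (l ∷ i ∷ [] , i ∷ l ∷ []) ∷ (r ∷ i ∷ [] , i ∷ r ∷ []) ∷ []
carried e↓ = []
carried e↑ = []
carried (w↓ R) = []
carried (w↑ R) = []
carried (b↓ T) = (l ∷ i ∷ [] , i ∷ []) ∷ (r ∷ [] , i ∷ []) ∷ []
carried (b↑ R) = (i ∷ [] , l ∷ i ∷ []) ∷ (i ∷ [] , r ∷ []) ∷ []
carried (g↓ T) = (i ∷ i ∷ [] , i ∷ []) ∷ []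
carried (g↑ R) = (i ∷ [] , i ∷ i ∷ []) ∷ []
carried (assoc→ o A B C) = (l ∷ l ∷ [] , l ∷ []) ∷ (l ∷ r ∷ [] , r ∷ l ∷ []) ∷ (r ∷ [] , r ∷ r ∷ []) ∷ []
carried (assoc← o A B C) = (l ∷ [] , l ∷ l ∷ []) ∷ (r ∷ l ∷ [] , l ∷ r ∷ []) ∷ (r ∷ r ∷ [] , r ∷ []) ∷ []
carried (commPar A B) = (l ∷ [] , r ∷ []) ∷ (r ∷ [] , l ∷ []) ∷ []
carried (commTen A B) = (l ∷ [] , r ∷ []) ∷ (r ∷ [] , l ∷ []) ∷ []
carried (unitR→ o A) = (l ∷ [] , []) ∷ []
carried (unitR← o A) = ([] , l ∷ []) ∷ []
carried (unitL→ o A) = (r ∷ [] , []) ∷ []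
carried (unitL← o A) = ([] , r ∷ []) ∷ []

-- Displayed !/? occurrences traced from premise to conclusion
-- (b↑, b↓: the displayed !R / ?T; g↑, g↓: both nested ones; p↓, p↑).
displayed : ∀ {P Q} → Rule P Q → List (Path × Path)
displayed (p↓ R T) = ([] , l ∷ []) ∷ []
displayed (p↑ R T) = (l ∷ [] , []) ∷ []
displayed (b↓ T) = (l ∷ [] , []) ∷ []
displayed (b↑ R) = ([] , l ∷ []) ∷ []
displayed (g↓ T) = ([] , []) ∷ (i ∷ [] , []) ∷ []
displayed (g↑ R) = ([] , []) ∷ ([] , i ∷ []) ∷ []
displayed _ = []

LTrace : ∀ {P Q} → Rule P Q → Path → Path → Set
LTrace ρ p q =
  (Σ (Path × Path) λ uv → uv ∈ carried ρ ×
     (let (u , v) = uv in ∃ λ w → p ≡ u ++ w × q ≡ v ++ w))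
  ⊎ ((p , q) ∈ displayed ρ)

data CTrace {P Q : Str} (C : Ctx) (ρ : Rule P Q) : Path → Path → Set where
  outside : (p : Path) → ¬ (∃ λ w → holePath C ++ w ≡ p) → CTrace C ρ p p
  inside  : (p q : Path) → LTrace ρ p q → CTrace C ρ (holePath C ++ p) (holePath C ++ q)

data Side : Set where
  premSide conclSide : Side

data Extra : ∀ {P Q} → Rule P Q → Side × Path → Side × Path → Set where
  extra-p↓ : ∀ R T → Extra (p↓ R T) (conclSide , l ∷ []) (conclSide , r ∷ [])
  extra-p↑ : ∀ R T → Extra (p↑ R T) (premSide , l ∷ []) (premSide , r ∷ [])

-- Derivations: lines 0 (top) .. n (bottom); step k rewrites line k
-- (premise) into line k+1 (conclusion) in some context.

record Derivation : Set where
  field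
    n     : ℕ
    line  : Fin (ℕ.suc n) → Str
    ctx   : Fin n → Ctx
    lprem : Fin n → Str
    lconc : Fin n → Str
    rule  : (k : Fin n) → Rule (lprem k) (lconc k)
    prem-ok  : (k : Fin n) → line (inject₁ k) ≡ plug (ctx k) (lprem k)
    concl-ok : (k : Fin n) → line (suc k) ≡ plug (ctx k) (lconc k)

module FlowGraph (D : Derivation) where
  open Derivation D

  Vertex : Set
  Vertex = Fin (ℕ.suc n) × Path

  lineOf : Fin n → Side → Fin (ℕ.suc n)
  lineOf k premSide = inject₁ k
  lineOf k conclSide = suc k

  data Edge : Vertex → Vertex → Set where
    bangEdge : (k : Fin n) (p q : Path) → CTrace (ctx k) (rule k) p q →
               kindAt (line (inject₁ k)) p ≡ just bangK →
               kindAt (line (suc k)) q ≡ just bangK →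
               Edge (suc k , q) (inject₁ k , p)
    whyEdge  : (k : Fin n) (p q : Path) → CTrace (ctx k) (rule k) p q →
               kindAt (line (inject₁ k)) p ≡ just whyK →
               kindAt (line (suc k)) q ≡ just whyK →
               Edge (inject₁ k , p) (suc k , q)
    extraEdge : (k : Fin n) (s₁ s₂ : Side) (p q : Path) → Extra (rule k) (s₁ , p) (s₂ , q) →
               Edge (lineOf k s₁ , holePath (ctx k) ++ p) (lineOf k s₂ , holePath (ctx k) ++ q)

  data Walk : Vertex → Vertex → Set where
    edge : ∀ {u v} → Edge u v → Walk u v
    _◅_  : ∀ {u v w} → Edge u v → Walk v w → Walk u w

  OnWalk : ∀ {u w} → Vertex → Walk u w → Set
  OnWalk x (edge {u} {v} e) = x ≡ u ⊎ x ≡ v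
  OnWalk x (_◅_ {u} e c) = x ≡ u ⊎ OnWalk x c

  Cycle : Set
  Cycle = Σ Vertex λ v → Walk v v

  data IsB↑ : ∀ {P Q} → Rule P Q → Set where
    isB↑ : ∀ R → IsB↑ (b↑ R)

  data IsB↓ : ∀ {P Q} → Rule P Q → Set where
    isB↓ : ∀ T → IsB↓ (b↓ T)

  Forked : Cycle → Set
  Forked (v , c) =
    (∃ λ (k : Fin n) → IsB↑ (rule k) × ∃ λ p → ∃ λ q →
        OnWalk (suc k , holePath (ctx k) ++ l ∷ i ∷ p) c
      × OnWalk (suc k , holePath (ctx k) ++ r ∷ q) c)
    ⊎
    (∃ λ (k : Fin n) → IsB↓ (rule k) × ∃ λ p → ∃ λ q →
        OnWalk (inject₁ k , holePath (ctx k) ++ l ∷ i ∷ p) c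
      × OnWalk (inject₁ k , holePath (ctx k) ++ r ∷ q) c)

  Unforked : Cycle → Set
  Unforked c = ¬ Forked c

{-# OPTIONS --safe #-}
module Submission where

-- Evaluate the lines of a derivation in the three values neg < zer < pos, as one
-- compares two points of a coherence space: par, tensor and seq are monotone with
-- unit zer, and every rule of SNEL without exponentials is non-decreasing from
-- premise to conclusion. Let an unforked cycle contribute pos (in a tensor) at each
-- of its !-vertices, neg (in a par) at each of its ?-vertices, and let everything
-- else be zer. Turning at p↓ and p↑ then behaves like the interaction rules ai↓ and
-- ai↑, and unforkedness makes one copy in b↓ and b↑ a unit, so all steps are
-- non-decreasing. A cycle cannot visit the top or the bottom line, which
-- therefore have value zer; so all lines have value zer. But an expression has
-- value zer only if all its leaves do, so the cycle has no vertices.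

open import Defs
open import Data.Bool using (Bool; true; false; T)
open import Data.Bool.Properties using (T-≡; ⇔→≡)
open import Data.Nat using (ℕ)
open import Data.Empty using (⊥)
open import Data.Fin using (Fin; zero; suc; inject₁; fromℕ)
open import Data.Fin.Induction using (<-weakInduction; >-weakInduction)
open import Data.Fin.Properties as Fin using (inject₁-injective; suc-injective; fromℕ≢inject₁)
open import Data.List using (List; []; _∷_; _++_; map; concatMap)
open import Data.List.Membership.Propositional using (_∈_; lose)
open import Data.List.Membership.Propositional.Properties using (∈-++⁺ˡ; ∈-++⁺ʳ; ∈-map⁺; ∈-concatMap⁺)
open import Data.List.Properties using (++-cancelˡ; ++-identityʳ; ≡-dec)
open import Data.List.Relation.Unary.Any as Any using (Any; here; there)
open import Data.Maybe using (Maybe; just; nothing)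
open import Data.Product using (Σ; ∃; _×_; _,_; proj₁; proj₂; swap)
open import Data.Product.Properties using () renaming (≡-dec to ×-≡-dec)
open import Data.Sum using (_⊎_; inj₁; inj₂)
open import Function using (_∘_; id; case_of_; mk⇔; Equivalence)
open import Relation.Binary.Definitions using (DecidableEquality)
open import Relation.Binary.PropositionalEquality using (_≡_; refl; sym; trans; cong; cong₂; subst; _≗_)
open import Relation.Nullary using (¬_; Dec; yes; no; contradiction; ⌊_⌋)
open import Relation.Nullary.Decidable using (T?; map′; _×-dec_; _⊎-dec_; _→-dec_; toWitness; fromWitness; decidable-stable)

-- Three values, their order, and the connectives on them

data Val : Set where
  neg zer pos : Val

data _≤_ : Val → Val → Set where
  neg≤    : ∀ {y} → neg ≤ y
  zer≤zer : zer ≤ zer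
  ≤pos    : ∀ {x} → x ≤ pos

_≤?_ : ∀ x y → Dec (x ≤ y)
neg ≤? y   = yes neg≤
zer ≤? neg = no λ ()
zer ≤? zer = yes zer≤zer
zer ≤? pos = yes ≤pos
pos ≤? neg = no λ ()
pos ≤? zer = no λ ()
pos ≤? pos = yes ≤pos

-- There are only three values, so a universally quantified inequality can be decided by exhaustion.
-- The laws below apply `toWitness` to such a decision, which evaluates to `yes`.
all? : {P : Val → Set} → (∀ x → Dec (P x)) → Dec (∀ x → P x)
all? P? = map′ (λ { (n , z , p) → λ { neg → n ; zer → z ; pos → p } })
               (λ f → f neg , f zer , f pos)
               (P? neg ×-dec P? zer ×-dec P? pos)

allOp? : {P : Op → Set} → (∀ o → Dec (P o)) → Dec (∀ o → P o)
allOp? P? = map′ (λ { (p , t , σ) → λ { Par → p ; Ten → t ; Seq → σ } })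
                 (λ f → f Par , f Ten , f Seq)
                 (P? Par ×-dec P? Ten ×-dec P? Seq)

≤-refl : ∀ x → x ≤ x
≤-refl = toWitness {a? = all? λ x → x ≤? x} _

≤-trans : ∀ {x y z} → x ≤ y → y ≤ z → x ≤ z
≤-trans neg≤    _       = neg≤
≤-trans zer≤zer y≤z     = y≤z
≤-trans ≤pos    ≤pos    = ≤pos

≤-zer-antisym : ∀ {x} → zer ≤ x → x ≤ zer → x ≡ zer
≤-zer-antisym zer≤zer _ = refl
≤-zer-antisym ≤pos ()

-- neg, zer, pos stand for strictly incoherent, equal, strictly coherent.
op : Op → Val → Val → Val
op Par pos _   = pos
op Par zer y   = y
op Par neg pos = pos
op Par neg _   = neg
op Ten neg _   = neg
op Ten zer y   = y
op Ten pos neg = neg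
op Ten pos _   = pos
op Seq zer y   = y
op Seq x   _   = x

op-mono : ∀ o a a′ b b′ → a ≤ a′ → b ≤ b′ → op o a b ≤ op o a′ b′
op-mono = toWitness {a? = allOp? λ o → all? λ a → all? λ a′ → all? λ b → all? λ b′ →
  (a ≤? a′) →-dec ((b ≤? b′) →-dec (op o a b ≤? op o a′ b′))} _

-- Opposite signs never cancel: `pos` wins in a par, `neg` in a tensor, and the first nonzero
-- argument in a seq.
op-zerˡ : ∀ o x y → op o x y ≡ zer → x ≡ zer
op-zerˡ Par zer _ _ = refl
op-zerˡ Par neg neg ()
op-zerˡ Par neg zer ()
op-zerˡ Par neg pos ()
op-zerˡ Ten zer _ _ = refl
op-zerˡ Ten pos neg ()
op-zerˡ Ten pos zer ()
op-zerˡ Ten pos pos ()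
op-zerˡ Seq zer _ _ = refl

op-zerʳ : ∀ o x y → op o x y ≡ zer → y ≡ zer
op-zerʳ o x y e with op-zerˡ o x y e
op-zerʳ Par .zer y e | refl = e
op-zerʳ Ten .zer y e | refl = e
op-zerʳ Seq .zer y e | refl = e

s-law : ∀ R T U → op Ten (op Par R U) T ≤ op Par (op Ten R T) U
s-law = toWitness {a? = all? λ R → all? λ T → all? λ U →
  op Ten (op Par R U) T ≤? op Par (op Ten R T) U} _

q↓-law : ∀ R T U V → op Seq (op Par R U) (op Par T V) ≤ op Par (op Seq R T) (op Seq U V)
q↓-law = toWitness {a? = all? λ R → all? λ T → all? λ U → all? λ V →
  op Seq (op Par R U) (op Par T V) ≤? op Par (op Seq R T) (op Seq U V)} _

q↑-law : ∀ R T U V → op Ten (op Seq R U) (op Seq T V) ≤ op Seq (op Ten R T) (op Ten U V)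
q↑-law = toWitness {a? = all? λ R → all? λ T → all? λ U → all? λ V →
  op Ten (op Seq R U) (op Seq T V) ≤? op Seq (op Ten R T) (op Ten U V)} _

assoc→-law : ∀ o A B C → op o (op o A B) C ≤ op o A (op o B C)
assoc→-law = toWitness {a? = allOp? λ o → all? λ A → all? λ B → all? λ C →
  op o (op o A B) C ≤? op o A (op o B C)} _

assoc←-law : ∀ o A B C → op o A (op o B C) ≤ op o (op o A B) C
assoc←-law = toWitness {a? = allOp? λ o → all? λ A → all? λ B → all? λ C →
  op o A (op o B C) ≤? op o (op o A B) C} _

commPar-law : ∀ A B → op Par A B ≤ op Par B A
commPar-law = toWitness {a? = all? λ A → all? λ B → op Par A B ≤? op Par B A} _

commTen-law : ∀ A B → op Ten A B ≤ op Ten B A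
commTen-law = toWitness {a? = all? λ A → all? λ B → op Ten A B ≤? op Ten B A} _

unitR→-law : ∀ o A → op o A zer ≤ A
unitR→-law = toWitness {a? = allOp? λ o → all? λ A → op o A zer ≤? A} _

unitR←-law : ∀ o A → A ≤ op o A zer
unitR←-law = toWitness {a? = allOp? λ o → all? λ A → A ≤? op o A zer} _

unitL→-law : ∀ o A → op o zer A ≤ A
unitL→-law = toWitness {a? = allOp? λ o → all? λ A → op o zer A ≤? A} _

unitL←-law : ∀ o A → A ≤ op o zer A
unitL←-law = toWitness {a? = allOp? λ o → all? λ A → A ≤? op o zer A} _

-- Marks on exponentials and the laws of the exponential rules

bangV : Bool → Val → Val
bangV true  x = op Ten pos x
bangV false x = x

whyV : Bool → Val → Val
whyV true  x = op Par neg x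
whyV false x = x

allBool? : {P : Bool → Set} → (∀ x → Dec (P x)) → Dec (∀ x → P x)
allBool? P? = map′ (λ { (t , f) → λ { true → t ; false → f } })
                   (λ h → h true , h false)
                   (P? true ×-dec P? false)

bangV-mono : ∀ b x y → x ≤ y → bangV b x ≤ bangV b y
bangV-mono = toWitness {a? = allBool? λ b → all? λ x → all? λ y →
  (x ≤? y) →-dec (bangV b x ≤? bangV b y)} _

whyV-mono : ∀ b x y → x ≤ y → whyV b x ≤ whyV b y
whyV-mono = toWitness {a? = allBool? λ b → all? λ x → all? λ y →
  (x ≤? y) →-dec (whyV b x ≤? whyV b y)} _

-- With `a` the mark of `![R,T]`, `b` of `!R` and `c` of `?T`, the hypotheses say that `b` holds iff
-- `a` or `c` does. A turn marks `!R` and `?T` together, and `op Par pos neg` is `pos`, which lies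
-- above `zer`, as for ai↓.
p↓-law : ∀ a b c x y → (T b → T a ⊎ T c) → (T a → T b) → (T c → T b) →
         bangV a (op Par x y) ≤ op Par (bangV b x) (whyV c y)
p↓-law = toWitness {a? = allBool? λ a → allBool? λ b → allBool? λ c → all? λ x → all? λ y →
  (T? b →-dec (T? a ⊎-dec T? c)) →-dec ((T? a →-dec T? b) →-dec ((T? c →-dec T? b) →-dec
  (bangV a (op Par x y) ≤? op Par (bangV b x) (whyV c y))))} _

p↑-law : ∀ a b c x y → (T a → T c ⊎ T b) → (T b → T a) → (T c → T a) →
         op Ten (whyV a x) (bangV b y) ≤ whyV c (op Ten x y)
p↑-law = toWitness {a? = allBool? λ a → allBool? λ b → allBool? λ c → all? λ x → all? λ y →
  (T? a →-dec (T? c ⊎-dec T? b)) →-dec ((T? b →-dec T? a) →-dec ((T? c →-dec T? a) →-dec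
  (op Ten (whyV a x) (bangV b y) ≤? whyV c (op Ten x y))))} _

-- The hypotheses make `c` the disjunction of `a` and `b`. Two nested marks count as one because
-- `op Par neg neg` is `neg`.
g↓-law : ∀ a b c x → (T a → T c) → (T b → T c) → (T c → T a ⊎ T b) →
         whyV a (whyV b x) ≤ whyV c x
g↓-law = toWitness {a? = allBool? λ a → allBool? λ b → allBool? λ c → all? λ x →
  (T? a →-dec T? c) →-dec ((T? b →-dec T? c) →-dec ((T? c →-dec (T? a ⊎-dec T? b)) →-dec
  (whyV a (whyV b x) ≤? whyV c x)))} _

g↑-law : ∀ a b c x → (T a → T c) → (T b → T c) → (T c → T a ⊎ T b) →
         bangV c x ≤ bangV a (bangV b x)
g↑-law = toWitness {a? = allBool? λ a → allBool? λ b → allBool? λ c → all? λ x →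
  (T? a →-dec T? c) →-dec ((T? b →-dec T? c) →-dec ((T? c →-dec (T? a ⊎-dec T? b)) →-dec
  (bangV c x ≤? bangV a (bangV b x))))} _

-- Here `zer` is the value of an unmarked copy inside the displayed exponential. If the other copy
-- is the unmarked one, a unit law suffices.
b↓-lawʳ : ∀ a x → op Par (whyV a zer) x ≤ whyV a x
b↓-lawʳ = toWitness {a? = allBool? λ a → all? λ x → op Par (whyV a zer) x ≤? whyV a x} _

b↑-lawʳ : ∀ a x → bangV a x ≤ op Ten (bangV a zer) x
b↑-lawʳ = toWitness {a? = allBool? λ a → all? λ x → bangV a x ≤? op Ten (bangV a zer) x} _

-- The value of a structure under a marking of its positions

T-ext : ∀ {a b} → (T a → T b) → (T b → T a) → a ≡ b
T-ext f g = ⇔→≡ (mk⇔ (to T-≡ ∘ f ∘ from T-≡) (to T-≡ ∘ g ∘ from T-≡))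
  where open Equivalence

¬T⇒false : ∀ {a} → ¬ T a → a ≡ false
¬T⇒false ¬a = T-ext ¬a λ ()

-- The marking is total on paths, but only its values at exponentials matter. Composing it with a
-- direction restricts it to a child.
val : Str → (Path → Bool) → Val
val (atom _)    m = zer
val unit        m = zer
val (bin o a b) m = op o (val a (m ∘ (l ∷_))) (val b (m ∘ (r ∷_)))
val (why a)     m = whyV (m []) (val a (m ∘ (i ∷_)))
val (bang a)    m = bangV (m []) (val a (m ∘ (i ∷_)))

val-cong : ∀ S {m m′} → m ≗ m′ → val S m ≡ val S m′
val-cong (atom _)    e = refl
val-cong unit        e = refl
val-cong (bin o a b) e = cong₂ (op o) (val-cong a (e ∘ (l ∷_))) (val-cong b (e ∘ (r ∷_)))
val-cong (why a)     e = cong₂ whyV (e []) (val-cong a (e ∘ (i ∷_)))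
val-cong (bang a)    e = cong₂ bangV (e []) (val-cong a (e ∘ (i ∷_)))

val-unmarked : ∀ S {m} → (∀ p → ¬ T (m p)) → val S m ≡ zer
val-unmarked S ¬m = trans (val-cong S (¬T⇒false ∘ ¬m)) (blank S)
  where
  blank : ∀ S → val S (λ _ → false) ≡ zer
  blank (atom _)    = refl
  blank unit        = refl
  blank (bin o a b) rewrite blank a | blank b with o
  ... | Par = refl
  ... | Ten = refl
  ... | Seq = refl
  blank (why a)     = blank a
  blank (bang a)    = blank a

whyV-zer : ∀ b x → whyV b x ≡ zer → ¬ T b × x ≡ zer
whyV-zer false x   e = id , e
whyV-zer true  neg ()
whyV-zer true  zer ()
whyV-zer true  pos ()

bangV-zer : ∀ b x → bangV b x ≡ zer → ¬ T b × x ≡ zer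
bangV-zer false x   e = id , e
bangV-zer true  neg ()
bangV-zer true  zer ()
bangV-zer true  pos ()

-- Since nothing cancels, `zer` passes down from the root to every subterm. The kind hypothesis
-- makes `p` an exponential, where a mark would contribute.
val-zer⇒unmarked : ∀ S {m} p {κ} → val S m ≡ zer → kindAt S p ≡ just κ → ¬ T (m p)
val-zer⇒unmarked (why a)     []      e _ = proj₁ (whyV-zer _ _ e)
val-zer⇒unmarked (bang a)    []      e _ = proj₁ (bangV-zer _ _ e)
val-zer⇒unmarked (bin o a b) (l ∷ p) e   = val-zer⇒unmarked a p (op-zerˡ o _ _ e)
val-zer⇒unmarked (bin o a b) (r ∷ p) e   = val-zer⇒unmarked b p (op-zerʳ o _ _ e)
val-zer⇒unmarked (why a) {m} (i ∷ p) e   = val-zer⇒unmarked a p (proj₂ (whyV-zer (m []) _ e))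
val-zer⇒unmarked (bang a) {m} (i ∷ p) e  = val-zer⇒unmarked a p (proj₂ (bangV-zer (m []) _ e))

-- All connectives are monotone and the context has the same marks on both lines.
val-plug : ∀ C {P Q m m′} →
           (∀ p → ¬ (∃ λ w → holePath C ++ w ≡ p) → m p ≡ m′ p) →
           val P (m ∘ (holePath C ++_)) ≤ val Q (m′ ∘ (holePath C ++_)) →
           val (plug C P) m ≤ val (plug C Q) m′
val-plug hole         out h = h
val-plug (binL o C t) {m = m} out h
  rewrite val-cong t {m ∘ (r ∷_)} (λ p → out (r ∷ p) λ ())
  = op-mono o _ _ _ _ (val-plug C (λ p ¬w → out (l ∷ p) λ { (w , refl) → ¬w (w , refl) }) h) (≤-refl _)
val-plug (binR o t C) {m = m} out h
  rewrite val-cong t {m ∘ (l ∷_)} (λ p → out (l ∷ p) λ ())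
  = op-mono o _ _ _ _ (≤-refl _) (val-plug C (λ p ¬w → out (r ∷ p) λ { (w , refl) → ¬w (w , refl) }) h)
-- The root is a proper prefix of the hole path, hence outside the hole, so the mark of the
-- enclosing exponential is unchanged.
val-plug (whyC C) {P} {Q} {m} {m′} out h rewrite out [] (λ ())
  = whyV-mono (m′ []) _ _ (val-plug C {P} {Q} {m ∘ (i ∷_)} (λ p ¬w → out (i ∷ p) λ { (w , refl) → ¬w (w , refl) }) h)
val-plug (bangC C) {P} {Q} {m} {m′} out h rewrite out [] (λ ())
  = bangV-mono (m′ []) _ _ (val-plug C {P} {Q} {m ∘ (i ∷_)} (λ p ¬w → out (i ∷ p) λ { (w , refl) → ¬w (w , refl) }) h)

-- Computing the neighbours of a position in a rule

opp : Side → Side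
opp premSide  = conclSide
opp conclSide = premSide

-- The first position is the one on side `σ`, so that both directions across a step are treated
-- uniformly.
along : Side → (Path → Path → Set) → Path → Path → Set
along premSide  _∼_ p q = p ∼ q
along conclSide _∼_ p q = q ∼ p

orient : Side → List (Path × Path) → List (Path × Path)
orient premSide  = id
orient conclSide = map swap

strip : Path → Path → Maybe Path
strip []      p       = just p
strip (l ∷ u) (l ∷ p) = strip u p
strip (r ∷ u) (r ∷ p) = strip u p
strip (i ∷ u) (i ∷ p) = strip u p
strip _       _       = nothing

strip-++ : ∀ u w → strip u (u ++ w) ≡ just w
strip-++ []      w = refl
strip-++ (l ∷ u) w = strip-++ u w
strip-++ (r ∷ u) w = strip-++ u w
strip-++ (i ∷ u) w = strip-++ u w

graft : Path → Maybe Path → List Path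
graft v (just w) = (v ++ w) ∷ []
graft v nothing  = []

graftRoot : Path → Maybe Path → List Path
graftRoot v (just []) = v ∷ []
graftRoot v _         = []

-- The turning edges of p↓ and p↑, taken without direction.
partners : ∀ {P Q} → Rule P Q → Side → Path → List Path
partners (p↓ _ _) conclSide (l ∷ []) = (r ∷ []) ∷ []
partners (p↓ _ _) conclSide (r ∷ []) = (l ∷ []) ∷ []
partners (p↑ _ _) premSide  (l ∷ []) = (r ∷ []) ∷ []
partners (p↑ _ _) premSide  (r ∷ []) = (l ∷ []) ∷ []
partners _        _         _        = []

images : ∀ {P Q} → Rule P Q → Side → Path → List Path
images ρ σ p = concatMap (λ (u , v) → graft v (strip u p)) (orient σ (carried ρ))
            ++ concatMap (λ (u , v) → graftRoot v (strip u p)) (orient σ (displayed ρ))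

-- Being a computed list, this normalises for a concrete rule and position: the hypotheses of
-- `carry` become `refl`, and matching on `Any` leaves exactly the possible neighbours.
neighbours : ∀ {P Q} → Rule P Q → Side → Path → List (Side × Path)
neighbours ρ σ p = map (opp σ ,_) (images ρ σ p) ++ map (σ ,_) (partners ρ σ p)

carried⇒images : ∀ {P Q} (ρ : Rule P Q) σ u v w →
                 (u , v) ∈ orient σ (carried ρ) → v ++ w ∈ images ρ σ (u ++ w)
carried⇒images ρ σ u v w uv∈ = ∈-++⁺ˡ (∈-concatMap⁺ _ (lose uv∈ grafted))
  where
  grafted : v ++ w ∈ graft v (strip u (u ++ w))
  grafted rewrite strip-++ u w = here refl

displayed⇒images : ∀ {P Q} (ρ : Rule P Q) σ u v →
                   (u , v) ∈ orient σ (displayed ρ) → v ∈ images ρ σ u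
displayed⇒images ρ σ u v uv∈ = ∈-++⁺ʳ _ (∈-concatMap⁺ _ (lose uv∈ grafted))
  where
  grafted : v ∈ graftRoot v (strip u u)
  grafted rewrite trans (cong (strip u) (sym (++-identityʳ u))) (strip-++ u []) = here refl

LTrace⇒images : ∀ {P Q} (ρ : Rule P Q) σ {p q} → along σ (LTrace ρ) p q → q ∈ images ρ σ p
LTrace⇒images ρ premSide  (inj₁ ((u , v) , uv∈ , w , refl , refl)) = carried⇒images ρ premSide u v w uv∈
LTrace⇒images ρ premSide  (inj₂ pq∈) = displayed⇒images ρ premSide _ _ pq∈
LTrace⇒images ρ conclSide (inj₁ ((u , v) , uv∈ , w , refl , refl)) = carried⇒images ρ conclSide v u w (∈-map⁺ swap uv∈)
LTrace⇒images ρ conclSide (inj₂ pq∈) = displayed⇒images ρ conclSide _ _ (∈-map⁺ swap pq∈)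

Extra⇒partners : ∀ {P Q} {ρ : Rule P Q} {σ p q} → Extra ρ (σ , p) (σ , q) →
                 q ∈ partners ρ σ p × p ∈ partners ρ σ q
Extra⇒partners (extra-p↓ _ _) = here refl , here refl
Extra⇒partners (extra-p↑ _ _) = here refl , here refl

-- Monotonicity of a single rule instance

module LocalStep (D : Derivation) where
  open FlowGraph D using (IsB↑; isB↑; IsB↓; isB↓)

  -- What a step needs to know about the cycle: each visited position has a visited neighbour in the
  -- step, and two copies are not both visited. Edge directions are forgotten.
  record Flow {P Q} (ρ : Rule P Q) : Set where
    field
      mark    : Side → Path → Bool
      flow    : ∀ σ p → T (mark σ p) → Any (λ (σ , q) → T (mark σ q)) (neighbours ρ σ p)
      unfork↑ : IsB↑ ρ → ∀ p q → T (mark conclSide (l ∷ i ∷ p)) → ¬ T (mark conclSide (r ∷ q))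
      unfork↓ : IsB↓ ρ → ∀ p q → T (mark premSide (l ∷ i ∷ p)) → ¬ T (mark premSide (r ∷ q))

    mp mc : Path → Bool
    mp = mark premSide
    mc = mark conclSide

    -- Corresponding positions are each other's only neighbours, so one is visited iff the other is.
    carry : ∀ X u v →
            (∀ w → neighbours ρ premSide (u ++ w) ≡ (conclSide , v ++ w) ∷ []) →
            (∀ w → neighbours ρ conclSide (v ++ w) ≡ (premSide , u ++ w) ∷ []) →
            val X (mp ∘ (u ++_)) ≡ val X (mc ∘ (v ++_))
    carry X u v down up = val-cong X λ w → T-ext
      (λ t → only (subst (Any _) (down w) (flow premSide (u ++ w) t)))
      (λ t → only (subst (Any _) (up w) (flow conclSide (v ++ w) t)))
      where
      only : ∀ {x} → Any (λ (σ , q) → T (mark σ q)) (x ∷ []) → T (mark (proj₁ x) (proj₂ x))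
      only (here t) = t

    -- A structure created or erased by the rule has no neighbours to continue to, so the cycle
    -- avoids it.
    unborn : ∀ X σ → (∀ w → neighbours ρ σ w ≡ []) → val X (mark σ) ≡ zer
    unborn X σ none = val-unmarked X λ w t → contradiction (subst (Any _) (none w) (flow σ w t)) λ ()

  open Flow

  local-mono : ∀ {P Q} (ρ : Rule P Q) (F : Flow ρ) → val P (mp F) ≤ val Q (mc F)
  local-mono (ai↓ a) F = zer≤zer
  local-mono (ai↑ a) F = zer≤zer
  local-mono (s R T U) F
    rewrite carry F R (l ∷ l ∷ []) (l ∷ l ∷ []) (λ _ → refl) (λ _ → refl)
          | carry F U (l ∷ r ∷ []) (r ∷ []) (λ _ → refl) (λ _ → refl)
          | carry F T (r ∷ []) (l ∷ r ∷ []) (λ _ → refl) (λ _ → refl)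
    = s-law (val R _) (val T _) (val U _)
  local-mono (q↓ R T U V) F
    rewrite carry F R (l ∷ l ∷ []) (l ∷ l ∷ []) (λ _ → refl) (λ _ → refl)
          | carry F U (l ∷ r ∷ []) (r ∷ l ∷ []) (λ _ → refl) (λ _ → refl)
          | carry F T (r ∷ l ∷ []) (l ∷ r ∷ []) (λ _ → refl) (λ _ → refl)
          | carry F V (r ∷ r ∷ []) (r ∷ r ∷ []) (λ _ → refl) (λ _ → refl)
    = q↓-law (val R _) (val T _) (val U _) (val V _)
  local-mono (q↑ R T U V) F
    rewrite carry F R (l ∷ l ∷ []) (l ∷ l ∷ []) (λ _ → refl) (λ _ → refl)
          | carry F U (l ∷ r ∷ []) (r ∷ l ∷ []) (λ _ → refl) (λ _ → refl)
          | carry F T (r ∷ l ∷ []) (l ∷ r ∷ []) (λ _ → refl) (λ _ → refl)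
          | carry F V (r ∷ r ∷ []) (r ∷ r ∷ []) (λ _ → refl) (λ _ → refl)
    = q↑-law (val R _) (val T _) (val U _) (val V _)
  local-mono (p↓ R T) F
    rewrite carry F R (i ∷ l ∷ []) (l ∷ i ∷ []) (λ _ → refl) (λ _ → refl)
          | carry F T (i ∷ r ∷ []) (r ∷ i ∷ []) (λ _ → refl) (λ _ → refl)
    -- Of the three displayed exponentials only `!R` has two neighbours: `![R,T]` across the step
    -- and `?T` by the turn.
    = p↓-law (mp F []) (mc F (l ∷ [])) (mc F (r ∷ [])) _ _
        (λ t → case flow F conclSide (l ∷ []) t of λ { (here t) → inj₁ t ; (there (here t)) → inj₂ t })
        (λ t → case flow F premSide [] t of λ { (here t) → t })
        (λ t → case flow F conclSide (r ∷ []) t of λ { (here t) → t })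
  local-mono (p↑ R T) F
    rewrite carry F R (l ∷ i ∷ []) (i ∷ l ∷ []) (λ _ → refl) (λ _ → refl)
          | carry F T (r ∷ i ∷ []) (i ∷ r ∷ []) (λ _ → refl) (λ _ → refl)
    = p↑-law (mp F (l ∷ [])) (mp F (r ∷ [])) (mc F []) _ _
        (λ t → case flow F premSide (l ∷ []) t of λ { (here t) → inj₁ t ; (there (here t)) → inj₂ t })
        (λ t → case flow F premSide (r ∷ []) t of λ { (here t) → t })
        (λ t → case flow F conclSide [] t of λ { (here t) → t })
  local-mono e↓ F rewrite unborn F (bang unit) conclSide (λ _ → refl) = zer≤zer
  local-mono e↑ F rewrite unborn F (why unit) premSide (λ _ → refl) = zer≤zer
  local-mono (w↓ R) F rewrite unborn F (why R) conclSide (λ _ → refl) = zer≤zer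
  local-mono (w↑ R) F rewrite unborn F (bang R) premSide (λ _ → refl) = zer≤zer
  local-mono (b↓ X) F rewrite T-ext {mp F (l ∷ [])} {mc F []}
      (λ t → case flow F premSide (l ∷ []) t of λ { (here t) → t })
      (λ t → case flow F conclSide [] t of λ { (here t) → t })
    -- Which copy is blank is a question about all paths. As the inequality is decidable, it may be
    -- assumed to fail: then neither copy is blank, and a visited position in each contradicts
    -- unforkedness.
    = decidable-stable (_ ≤? _) λ ≰ →
        ≰ (ifLeftBlank λ p tp → ≰ (ifRightBlank λ q tq → unfork↓ F (isB↓ X) p q tp tq))
    where
    concl = whyV (mc F []) (val X (mc F ∘ (i ∷_)))

    -- Every visited position of the conclusion's copy must then continue into the right copy, so
    -- these two have the same marks.
    ifLeftBlank : (∀ p → ¬ T (mp F (l ∷ i ∷ p))) →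
      op Par (whyV (mc F []) (val X (mp F ∘ (λ p → l ∷ i ∷ p)))) (val X (mp F ∘ (r ∷_))) ≤ concl
    ifLeftBlank blank
      rewrite val-unmarked X blank
            | val-cong X {mp F ∘ (r ∷_)} {mc F ∘ (i ∷_)} (λ w → T-ext
                (λ t → case flow F premSide (r ∷ w) t of λ { (here t) → t })
                (λ t → case flow F conclSide (i ∷ w) t of λ
                  { (here t) → contradiction t (blank w) ; (there (here t)) → t }))
      = b↓-lawʳ (mc F []) _

    ifRightBlank : (∀ p → ¬ T (mp F (r ∷ p))) →
      op Par (whyV (mc F []) (val X (mp F ∘ (λ p → l ∷ i ∷ p)))) (val X (mp F ∘ (r ∷_))) ≤ concl
    ifRightBlank blank
      rewrite val-unmarked X blank
            | val-cong X {mp F ∘ (λ p → l ∷ i ∷ p)} {mc F ∘ (i ∷_)} (λ w → T-ext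
                (λ t → case flow F premSide (l ∷ i ∷ w) t of λ { (here t) → t })
                (λ t → case flow F conclSide (i ∷ w) t of λ
                  { (here t) → t ; (there (here t)) → contradiction t (blank w) }))
      = unitR→-law Par _
  local-mono (b↑ X) F rewrite T-ext {mp F []} {mc F (l ∷ [])}
      (λ t → case flow F premSide [] t of λ { (here t) → t })
      (λ t → case flow F conclSide (l ∷ []) t of λ { (here t) → t })
    = decidable-stable (_ ≤? _) λ ≰ →
        ≰ (ifLeftBlank λ p tp → ≰ (ifRightBlank λ q tq → unfork↑ F (isB↑ X) p q tp tq))
    where
    prem = bangV (mc F (l ∷ [])) (val X (mp F ∘ (i ∷_)))

    ifLeftBlank : (∀ p → ¬ T (mc F (l ∷ i ∷ p))) →
      prem ≤ op Ten (bangV (mc F (l ∷ [])) (val X (mc F ∘ (λ p → l ∷ i ∷ p)))) (val X (mc F ∘ (r ∷_)))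
    ifLeftBlank blank
      rewrite val-unmarked X blank
            | val-cong X {mc F ∘ (r ∷_)} {mp F ∘ (i ∷_)} (λ w → T-ext
                (λ t → case flow F conclSide (r ∷ w) t of λ { (here t) → t })
                (λ t → case flow F premSide (i ∷ w) t of λ
                  { (here t) → contradiction t (blank w) ; (there (here t)) → t }))
      = b↑-lawʳ (mc F (l ∷ [])) _

    ifRightBlank : (∀ p → ¬ T (mc F (r ∷ p))) →
      prem ≤ op Ten (bangV (mc F (l ∷ [])) (val X (mc F ∘ (λ p → l ∷ i ∷ p)))) (val X (mc F ∘ (r ∷_)))
    ifRightBlank blank
      rewrite val-unmarked X blank
            | val-cong X {mc F ∘ (λ p → l ∷ i ∷ p)} {mp F ∘ (i ∷_)} (λ w → T-ext
                (λ t → case flow F conclSide (l ∷ i ∷ w) t of λ { (here t) → t })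
                (λ t → case flow F premSide (i ∷ w) t of λ
                  { (here t) → t ; (there (here t)) → contradiction t (blank w) }))
      = unitR←-law Ten _
  local-mono (g↓ X) F
    rewrite carry F X (i ∷ i ∷ []) (i ∷ []) (λ _ → refl) (λ _ → refl)
    = g↓-law (mp F []) (mp F (i ∷ [])) (mc F []) _
        (λ t → case flow F premSide [] t of λ { (here t) → t })
        (λ t → case flow F premSide (i ∷ []) t of λ { (here t) → t })
        (λ t → case flow F conclSide [] t of λ { (here t) → inj₁ t ; (there (here t)) → inj₂ t })
  local-mono (g↑ X) F
    rewrite carry F X (i ∷ []) (i ∷ i ∷ []) (λ _ → refl) (λ _ → refl)
    = g↑-law (mc F []) (mc F (i ∷ [])) (mp F []) _
        (λ t → case flow F conclSide [] t of λ { (here t) → t })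
        (λ t → case flow F conclSide (i ∷ []) t of λ { (here t) → t })
        (λ t → case flow F premSide [] t of λ { (here t) → inj₁ t ; (there (here t)) → inj₂ t })
  local-mono (assoc→ o A B C) F
    rewrite carry F A (l ∷ l ∷ []) (l ∷ []) (λ _ → refl) (λ _ → refl)
          | carry F B (l ∷ r ∷ []) (r ∷ l ∷ []) (λ _ → refl) (λ _ → refl)
          | carry F C (r ∷ []) (r ∷ r ∷ []) (λ _ → refl) (λ _ → refl)
    = assoc→-law o _ _ _
  local-mono (assoc← o A B C) F
    rewrite carry F A (l ∷ []) (l ∷ l ∷ []) (λ _ → refl) (λ _ → refl)
          | carry F B (r ∷ l ∷ []) (l ∷ r ∷ []) (λ _ → refl) (λ _ → refl)
          | carry F C (r ∷ r ∷ []) (r ∷ []) (λ _ → refl) (λ _ → refl)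
    = assoc←-law o (val A _) (val B _) (val C _)
  local-mono (commPar A B) F
    rewrite carry F A (l ∷ []) (r ∷ []) (λ _ → refl) (λ _ → refl)
          | carry F B (r ∷ []) (l ∷ []) (λ _ → refl) (λ _ → refl)
    = commPar-law (val A _) (val B _)
  local-mono (commTen A B) F
    rewrite carry F A (l ∷ []) (r ∷ []) (λ _ → refl) (λ _ → refl)
          | carry F B (r ∷ []) (l ∷ []) (λ _ → refl) (λ _ → refl)
    = commTen-law (val A _) (val B _)
  local-mono (unitR→ o A) F
    rewrite carry F A (l ∷ []) [] (λ _ → refl) (λ _ → refl) = unitR→-law o _
  local-mono (unitR← o A) F
    rewrite carry F A [] (l ∷ []) (λ _ → refl) (λ _ → refl) = unitR←-law o _
  local-mono (unitL→ o A) F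
    rewrite carry F A (r ∷ []) [] (λ _ → refl) (λ _ → refl) = unitL→-law o _
  local-mono (unitL← o A) F
    rewrite carry F A [] (r ∷ []) (λ _ → refl) (λ _ → refl) = unitL←-law o _

-- Positions and traces inside and outside the hole

sub-plug : ∀ C X p → sub (plug C X) (holePath C ++ p) ≡ sub X p
sub-plug hole         X p = refl
sub-plug (binL o C t) X p = sub-plug C X p
sub-plug (binR o t C) X p = sub-plug C X p
sub-plug (whyC C)     X p = sub-plug C X p
sub-plug (bangC C)    X p = sub-plug C X p

CTrace-inside : ∀ {P Q} C (ρ : Rule P Q) σ {x y p} → along σ (CTrace C ρ) x y → x ≡ holePath C ++ p →
                ∃ λ q → y ≡ holePath C ++ q × along σ (LTrace ρ) p q
CTrace-inside C ρ premSide  (outside x ¬w)  e = contradiction (_ , sym e) ¬w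
CTrace-inside C ρ conclSide (outside x ¬w)  e = contradiction (_ , sym e) ¬w
CTrace-inside C ρ premSide  (inside p q tr) e with refl ← ++-cancelˡ (holePath C) p _ e = q , refl , tr
CTrace-inside C ρ conclSide (inside p q tr) e with refl ← ++-cancelˡ (holePath C) q _ e = p , refl , tr

CTrace-outside : ∀ {P Q} C (ρ : Rule P Q) σ {x y} → along σ (CTrace C ρ) x y →
                 ¬ (∃ λ w → holePath C ++ w ≡ x) → y ≡ x
CTrace-outside C ρ premSide  (outside x _)   _  = refl
CTrace-outside C ρ conclSide (outside x _)   _  = refl
CTrace-outside C ρ premSide  (inside p q tr) ¬w = contradiction (p , refl) ¬w
CTrace-outside C ρ conclSide (inside p q tr) ¬w = contradiction (q , refl) ¬w

_≟Dir_ : DecidableEquality Dir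
l ≟Dir l = yes refl
l ≟Dir r = no λ ()
l ≟Dir i = no λ ()
r ≟Dir l = no λ ()
r ≟Dir r = yes refl
r ≟Dir i = no λ ()
i ≟Dir l = no λ ()
i ≟Dir r = no λ ()
i ≟Dir i = yes refl

-- The kind of exponential whose edges leave the given side of a step.
sourceKind : Side → Kind
sourceKind premSide  = whyK
sourceKind conclSide = bangK

sourceKind-injective : ∀ σ τ → just (sourceKind σ) ≡ just (sourceKind τ) → σ ≡ τ
sourceKind-injective premSide  premSide  _ = refl
sourceKind-injective conclSide conclSide _ = refl

opp-cases : ∀ σ τ → τ ≡ σ ⊎ τ ≡ opp σ
opp-cases premSide  premSide  = inj₁ refl
opp-cases premSide  conclSide = inj₂ refl
opp-cases conclSide premSide  = inj₂ refl
opp-cases conclSide conclSide = inj₁ refl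

-- Adjacent vertices on a walk

module Walks (D : Derivation) where
  open FlowGraph D

  start-on : ∀ {u w} (c : Walk u w) → OnWalk u c
  start-on (edge e) = inj₁ refl
  start-on (e ◅ c)  = inj₁ refl

  first-edge : ∀ {u w} (c : Walk u w) → ∃ λ y → Edge u y × OnWalk y c
  first-edge (edge e) = _ , e , inj₂ refl
  first-edge (e ◅ c)  = _ , e , inj₂ (start-on c)

  last-edge : ∀ {u w} (c : Walk u w) → ∃ λ y → Edge y w × OnWalk y c
  last-edge (edge e) = _ , e , inj₁ refl
  last-edge (e ◅ c)  = let y , e′ , on = last-edge c in y , e′ , inj₂ on

  out-edge : ∀ {u w x} (c : Walk u w) → OnWalk x c → x ≡ w ⊎ ∃ λ y → Edge x y × OnWalk y c
  out-edge (edge e) (inj₁ refl) = inj₂ (_ , e , inj₂ refl)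
  out-edge (edge e) (inj₂ refl) = inj₁ refl
  out-edge (e ◅ c)  (inj₁ refl) = inj₂ (_ , e , inj₂ (start-on c))
  out-edge (e ◅ c)  (inj₂ on) with out-edge c on
  ... | inj₁ x≡w            = inj₁ x≡w
  ... | inj₂ (y , e′ , on′) = inj₂ (y , e′ , inj₂ on′)

  in-edge : ∀ {u w x} (c : Walk u w) → OnWalk x c → x ≡ u ⊎ ∃ λ y → Edge y x × OnWalk y c
  in-edge (edge e) (inj₁ refl) = inj₁ refl
  in-edge (edge e) (inj₂ refl) = inj₂ (_ , e , inj₁ refl)
  in-edge (e ◅ c)  (inj₁ refl) = inj₁ refl
  in-edge (e ◅ c)  (inj₂ on) with in-edge c on
  ... | inj₁ refl           = inj₂ (_ , e , inj₁ refl)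
  ... | inj₂ (y , e′ , on′) = inj₂ (y , e′ , inj₂ on′)

  _≟_ : DecidableEquality Vertex
  _≟_ = ×-≡-dec Fin._≟_ (≡-dec _≟Dir_)

  onWalk? : ∀ {u w} x (c : Walk u w) → Dec (OnWalk x c)
  onWalk? x (edge {u} {v} e) = (x ≟ u) ⊎-dec (x ≟ v)
  onWalk? x (_◅_ {u} e c)    = (x ≟ u) ⊎-dec onWalk? x c

-- Marking the lines of a derivation by an unforked cycle

module UnforkedCycle (D : Derivation) (cyc : FlowGraph.Cycle D) (unforked : FlowGraph.Unforked D cyc) where
  open Derivation D
  open FlowGraph D
  open Walks D
  open LocalStep D

  On : Vertex → Set
  On x = OnWalk x (proj₂ cyc)

  h : Fin n → Path
  h k = holePath (ctx k)

  kind : Vertex → Maybe Kind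
  kind (j , p) = kindAt (line j) p

  -- A visited neighbour of `x` in the step below its line (`premSide`) or in the step above it
  -- (`conclSide`), whatever the direction of the edge.
  data Link (σ : Side) (x : Vertex) : Set where
    trace : ∀ k p q → x ≡ (lineOf k σ , p) → along σ (CTrace (ctx k) (rule k)) p q →
            On (lineOf k (opp σ) , q) → Link σ x
    turn  : ∀ k p q → x ≡ (lineOf k σ , h k ++ p) → q ∈ partners (rule k) σ p →
            On (lineOf k σ , h k ++ q) → Link σ x

  localKind : ∀ {P Q} → Rule P Q → Side → Path → Maybe Kind
  localKind {P} {Q} ρ premSide  = kindAt P
  localKind {P} {Q} ρ conclSide = kindAt Q

  kind-local : ∀ k σ p → kind (lineOf k σ , h k ++ p) ≡ localKind (rule k) σ p
  kind-local k premSide  p rewrite prem-ok k  = cong kindOf (sub-plug (ctx k) _ p)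
  kind-local k conclSide p rewrite concl-ok k = cong kindOf (sub-plug (ctx k) _ p)

  -- A turn runs from `!` to `?` in the conclusion of p↓, and from `?` to `!` in the premise of p↑.
  -- It thus obeys the same rule as the traces on which kind may leave or enter a side.
  Extra-view : ∀ {P Q} {ρ : Rule P Q} {σ τ p q} → Extra ρ (σ , p) (τ , q) →
               σ ≡ τ × localKind ρ σ p ≡ just (sourceKind σ) × localKind ρ τ q ≡ just (sourceKind (opp σ))
  Extra-view (extra-p↓ _ _) = refl , refl , refl
  Extra-view (extra-p↑ _ _) = refl , refl , refl

  out-link : ∀ {x y} → Edge x y → On y → ∃ λ σ → kind x ≡ just (sourceKind σ) × Link σ x
  out-link (bangEdge k p q tr kp kq) on = conclSide , kq , trace k q p refl tr on
  out-link (whyEdge  k p q tr kp kq) on = premSide , kp , trace k p q refl tr on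
  out-link (extraEdge k σ τ p q ex)  on with refl , kp , kq ← Extra-view ex =
    σ , trans (kind-local k σ p) kp , turn k p q refl (proj₁ (Extra⇒partners ex)) on

  in-link : ∀ {x y} → Edge y x → On y → ∃ λ σ → kind x ≡ just (sourceKind (opp σ)) × Link σ x
  in-link (bangEdge k p q tr kp kq) on = premSide , kp , trace k p q refl tr on
  in-link (whyEdge  k p q tr kp kq) on = conclSide , kq , trace k q p refl tr on
  in-link (extraEdge k σ τ p q ex)  on with refl , kp , kq ← Extra-view ex =
    σ , trans (kind-local k σ q) kq , turn k q p refl (proj₂ (Extra⇒partners ex)) on

  -- Only the last vertex of the walk could lack a successor, and on a cycle it is also the first.
  succ : ∀ {x} → On x → ∃ λ y → Edge x y × On y
  succ on with out-edge (proj₂ cyc) on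
  ... | inj₁ refl = first-edge (proj₂ cyc)
  ... | inj₂ e    = e

  pred : ∀ {x} → On x → ∃ λ y → Edge y x × On y
  pred on with in-edge (proj₂ cyc) on
  ... | inj₁ refl = last-edge (proj₂ cyc)
  ... | inj₂ e    = e

  -- The edges entering and leaving a vertex of the cycle lie in the steps on
  -- opposite sides of its line; which is which depends on the kind of the vertex.
  link : ∀ σ {x} → On x → Link σ x
  link σ on =
    let y , e , on-y = succ on ; τ  , kx  , ln  = out-link e  on-y
        z , f , on-z = pred on ; τ′ , kx′ , ln′ = in-link  f  on-z
    in pick τ τ′ (sourceKind-injective τ (opp τ′) (trans (sym kx) kx′)) ln ln′
    where
    pick : ∀ τ τ′ {x} → τ ≡ opp τ′ → Link τ x → Link τ′ x → Link σ x
    pick .(opp τ′) τ′ refl ln ln′ with opp-cases τ′ σ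
    ... | inj₁ refl = ln′
    ... | inj₂ refl = ln

  mark : Fin (ℕ.suc n) → Path → Bool
  mark j p = ⌊ onWalk? (j , p) (proj₂ cyc) ⌋

  marked⇒on : ∀ j p → T (mark j p) → On (j , p)
  marked⇒on j p = toWitness

  on⇒marked : ∀ j p → On (j , p) → T (mark j p)
  on⇒marked j p = fromWitness

  lineOf-injective : ∀ σ {k k′} → lineOf k σ ≡ lineOf k′ σ → k ≡ k′
  lineOf-injective premSide  = inject₁-injective
  lineOf-injective conclSide = suc-injective

  step-flow : ∀ k σ p → On (lineOf k σ , h k ++ p) →
              Any (λ (τ , q) → On (lineOf k τ , h k ++ q)) (neighbours (rule k) σ p)
  step-flow k σ p on with link σ on
  -- A line is the `σ` side of at most one step, so the link found belongs to step `k`.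
  ... | trace k′ p′ q eq tr on′
      with refl ← lineOf-injective σ (cong proj₁ eq)
      with q′ , refl , tr′ ← CTrace-inside (ctx k) (rule k) σ tr (sym (cong proj₂ eq))
      = lose (∈-++⁺ˡ (∈-map⁺ (opp σ ,_) (LTrace⇒images (rule k) σ tr′))) on′
  ... | turn k′ p′ q eq q∈ on′
      with refl ← lineOf-injective σ (cong proj₁ eq)
      with refl ← ++-cancelˡ (h k) p p′ (cong proj₂ eq)
      = lose (∈-++⁺ʳ _ (∈-map⁺ (σ ,_) q∈)) on′

  -- Turns happen only within the hole, so here the link is a trace, which keeps the position.
  step-outside : ∀ k σ p → ¬ (∃ λ w → h k ++ w ≡ p) → On (lineOf k σ , p) → On (lineOf k (opp σ) , p)
  step-outside k σ p ¬w on with link σ on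
  ... | trace k′ p′ q eq tr on′
      with refl ← lineOf-injective σ (cong proj₁ eq)
      with refl ← cong proj₂ eq
      with refl ← CTrace-outside (ctx k) (rule k) σ tr ¬w
      = on′
  ... | turn k′ p′ q eq q∈ on′
      with refl ← lineOf-injective σ (cong proj₁ eq)
      = contradiction (p′ , sym (cong proj₂ eq)) ¬w

  step-Flow : ∀ k → Flow (rule k)
  step-Flow k = record
    { mark    = λ σ p → mark (lineOf k σ) (h k ++ p)
    ; flow    = λ σ p t → Any.map (on⇒marked _ _) (step-flow k σ p (marked⇒on _ _ t))
    ; unfork↑ = λ isB p q tp tq → unforked (inj₁ (k , isB , p , q , marked⇒on _ _ tp , marked⇒on _ _ tq))
    ; unfork↓ = λ isB p q tp tq → unforked (inj₂ (k , isB , p , q , marked⇒on _ _ tp , marked⇒on _ _ tq))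
    }

  lineVal : Fin (ℕ.suc n) → Val
  lineVal j = val (line j) (mark j)

  step-mono : ∀ k → lineVal (inject₁ k) ≤ lineVal (suc k)
  step-mono k rewrite prem-ok k | concl-ok k = val-plug (ctx k)
    (λ p ¬w → T-ext
      (λ t → on⇒marked _ _ (step-outside k premSide  p ¬w (marked⇒on _ _ t)))
      (λ t → on⇒marked _ _ (step-outside k conclSide p ¬w (marked⇒on _ _ t))))
    (local-mono (rule k) (step-Flow k))

  -- A visited vertex has a link in the step above its line, and the top line has no such step.
  top-unmarked : ∀ p → ¬ On (zero , p)
  top-unmarked p on with link conclSide on
  ... | trace _ _ _ () _ _
  ... | turn  _ _ _ () _ _

  bottom-unmarked : ∀ p → ¬ On (fromℕ n , p)
  bottom-unmarked p on with link premSide on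
  ... | trace _ _ _ eq _ _ = fromℕ≢inject₁ (cong proj₁ eq)
  ... | turn  _ _ _ eq _ _ = fromℕ≢inject₁ (cong proj₁ eq)

  -- Values never decrease downwards, and both end lines have value `zer`; induction from the top
  -- and from the bottom squeezes every line in between.
  lineVal-zer : ∀ j → lineVal j ≡ zer
  lineVal-zer j = ≤-zer-antisym
    (<-weakInduction (λ j → zer ≤ lineVal j)
      (subst (zer ≤_) (sym (val-unmarked (line zero) λ p → top-unmarked p ∘ marked⇒on _ _)) zer≤zer)
      (λ k zer≤ → ≤-trans zer≤ (step-mono k)) j)
    (>-weakInduction (λ j → lineVal j ≤ zer)
      (subst (_≤ zer) (sym (val-unmarked (line (fromℕ n)) λ p → bottom-unmarked p ∘ marked⇒on _ _)) zer≤zer)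
      (λ k ≤zer → ≤-trans (step-mono k) ≤zer) j)

  absurd : ⊥
  absurd =
    let (j , p) , c      = cyc
        on               = start-on c
        _ , e , on-y     = succ on
        _ , kx , _       = out-link e on-y
    -- The start of the cycle is the source of an edge, hence an exponential; `kx` records its kind.
    in val-zer⇒unmarked (line j) p (lineVal-zer j) kx (on⇒marked j p on)

theorem5p19 : ¬ (Σ Derivation λ D → Σ (FlowGraph.Cycle D) λ c → FlowGraph.Unforked D c)
theorem5p19 (D , c , unforked) = UnforkedCycle.absurd D c unforked
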